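{- For every $d\geq 1$, every set belonging to $\mathfrak{A}_d$, the set algebra of subsets of $\mathbb{R}^d$ generated by the semigroups in $\mathbb{R}^d$, is Erdős–Hajnal.
   Context: A semigroup in $\mathbb{R}^d$ is a subset of $\mathbb{R}^d$ closed under (vector) addition. $\mathfrak{A}_d$ is the smallest family of subsets of $\mathbb{R}^d$ that contains every semigroup and is closed under complement, finite union and finite intersection. For $S\subset\mathbb{R}^d$ and a finite $V\subset\mathbb{R}^d$, $\Gamma^S(V)$ is the digraph with vertex set $V$ in which, for distinct $x,y\in V$, $(x,y)$ is an edge iff $y-x\in S$ (loops are disregarded; both $(x,y)$ and $(y,x)$ may be edges). A vertex subset $W\subset V$ induces: a complete graph if $(u,v)$ is an edge for all ordered pairs of distinct $u,v\in W$; an independent set if no such pair is an edge; a transitive tournament if $W$ can be enumerated $w_1,\dots,w_k$ so that $(w_i,w_j)$ is an edge iff $i<j$. The set $S$ is called Erdős–Hajnal if there exist $\epsilon>0$ and $c>0$ such that, for every finite $V\subset\mathbb{R}^d$ with $|V|=n$, there is $W\subset V$ with $|W|\geq c\,n^{\epsilon}$ inducing in $\Gamma^S(V)$ a complete graph, an independent set, or a transitive tournament. -}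

module Defs where

open import Data.Fin.Base as Fin using (Fin)
open import Data.Fin.Subset using (Subset; ∣_∣; _∈_)
open import Data.Integer.Base using (+_)
open import Data.Nat.Base as ℕ using (ℕ)
import Data.Nat.Properties as ℕ
open import Data.Product.Base using (Σ-syntax; ∃-syntax; _×_; _,_)
open import Data.Rational.Base as ℚ using (ℚ; 0ℚ; ½)
import Data.Rational.Properties as ℚ
open import Data.Rational.Solver using (module +-*-Solver)
open import Data.Sum.Base using (_⊎_)
open import Data.Vec.Functional using (Vector; zipWith)
open import Function.Bundles using (_⇔_)
open import Function.Definitions using (Injective)
open import Level using (0ℓ)
open import Relation.Binary.Core using (Rel)
open import Relation.Binary.Definitions using (_Respects_)
open import Relation.Binary.PropositionalEquality
  using (_≡_; _≢_; refl; sym; trans; cong; subst)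
open import Relation.Nullary.Negation.Core using (¬_)
open import Relation.Unary using (Pred; ∁; _∪_; _∩_; _≐_)

-- Real numbers: Cauchy sequences of rationals, compared up to null sequences.

IsCauchy : (ℕ → ℚ) → Set
IsCauchy x = ∀ ε → 0ℚ ℚ.< ε →
  ∃[ N ] (∀ m n → N ℕ.≤ m → N ℕ.≤ n → ℚ.∣ x m ℚ.- x n ∣ ℚ.< ε)

record ℝ : Set where
  constructor mkℝ
  field
    approx : ℕ → ℚ
    cauchy : IsCauchy approx

open ℝ public

infix  4 _≈ᴿ_ _<ᴿ_
infixl 6 _+ᴿ_ _-ᴿ_

_≈ᴿ_ : Rel ℝ 0ℓ
x ≈ᴿ y = ∀ ε → 0ℚ ℚ.< ε →
  ∃[ N ] (∀ n → N ℕ.≤ n → ℚ.∣ approx x n ℚ.- approx y n ∣ ℚ.< ε)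

-- Termwise strict inequality would not be invariant under _≈ᴿ_: the sequences
-- have to be eventually separated by a fixed positive rational.
_<ᴿ_ : Rel ℝ 0ℓ
x <ᴿ y = ∃[ δ ] (0ℚ ℚ.< δ ×
  (∃[ N ] (∀ n → N ℕ.≤ n → approx x n ℚ.+ δ ℚ.≤ approx y n)))

fromℚ : ℚ → ℝ
fromℚ q = mkℝ (λ _ → q) λ ε 0<ε →
  0 , λ _ _ _ _ → subst (ℚ._< ε) (sym (cong ℚ.∣_∣ (ℚ.+-inverseʳ q))) 0<ε

0ᴿ : ℝ
0ᴿ = fromℚ 0ℚ

private
  0<½* : ∀ {ε} → 0ℚ ℚ.< ε → 0ℚ ℚ.< ½ ℚ.* ε
  0<½* {ε} 0<ε = ℚ.*-monoʳ-<-pos ½ 0<ε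

  halves : ∀ ε → ½ ℚ.* ε ℚ.+ ½ ℚ.* ε ≡ ε
  halves ε = trans (sym (ℚ.*-distribʳ-+ ε ½ ½)) (ℚ.*-identityˡ ε)

  +-interchange : ∀ a b c d →
    (a ℚ.+ b) ℚ.- (c ℚ.+ d) ≡ (a ℚ.- c) ℚ.+ (b ℚ.- d)
  +-interchange = solve 4
    (λ a b c d → (a :+ b) :- (c :+ d) := (a :- c) :+ (b :- d)) refl
    where open +-*-Solver

  neg-interchange : ∀ a b → (ℚ.- a) ℚ.- (ℚ.- b) ≡ ℚ.- (a ℚ.- b)
  neg-interchange = solve 2 (λ a b → (:- a) :- (:- b) := :- (a :- b)) refl
    where open +-*-Solver

_+ᴿ_ : ℝ → ℝ → ℝ
approx (x +ᴿ y) n = approx x n ℚ.+ approx y n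
cauchy (x +ᴿ y) ε 0<ε
  with cauchy x (½ ℚ.* ε) (0<½* 0<ε) | cauchy y (½ ℚ.* ε) (0<½* 0<ε)
... | M , p | N , q = M ℕ.⊔ N , λ m n m≥ n≥ →
  let a = approx x m ; b = approx y m ; c = approx x n ; d = approx y n
      open ℚ.≤-Reasoning in
  begin-strict
    ℚ.∣ (a ℚ.+ b) ℚ.- (c ℚ.+ d) ∣
      ≡⟨ cong ℚ.∣_∣ (+-interchange a b c d) ⟩
    ℚ.∣ (a ℚ.- c) ℚ.+ (b ℚ.- d) ∣
      ≤⟨ ℚ.∣p+q∣≤∣p∣+∣q∣ (a ℚ.- c) (b ℚ.- d) ⟩
    ℚ.∣ a ℚ.- c ∣ ℚ.+ ℚ.∣ b ℚ.- d ∣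
      <⟨ ℚ.+-mono-<
           (p m n (ℕ.m⊔n≤o⇒m≤o M N m≥) (ℕ.m⊔n≤o⇒m≤o M N n≥))
           (q m n (ℕ.m⊔n≤o⇒n≤o M N m≥) (ℕ.m⊔n≤o⇒n≤o M N n≥)) ⟩
    ½ ℚ.* ε ℚ.+ ½ ℚ.* ε
      ≡⟨ halves ε ⟩
    ε ∎

-ᴿ_ : ℝ → ℝ
approx (-ᴿ x) n = ℚ.- approx x n
cauchy (-ᴿ x) ε 0<ε with cauchy x ε 0<ε
... | N , p = N , λ m n m≥ n≥ →
  subst (ℚ._< ε)
    (sym (trans (cong ℚ.∣_∣ (neg-interchange (approx x m) (approx x n)))
                (ℚ.∣-p∣≡∣p∣ (approx x m ℚ.- approx x n))))
    (p m n m≥ n≥)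

_-ᴿ_ : ℝ → ℝ → ℝ
x -ᴿ y = x +ᴿ (-ᴿ y)

-- c · n ^ ε ≤ m for real c, ε > 0. Since t ↦ n ^ t is continuous on t > 0,
-- and nondecreasing there (n being a natural number), c · n ^ ε is the supremum
-- of (a / b) · n ^ (p / q) over the rationals 0 ≤ a / b < c and 0 < p / q < ε;
-- the inequality (a / b) · n ^ (p / q) ≤ m reads a ^ q · n ^ p ≤ (b · m) ^ q.
-- Excluding p = 0 matters for n = 0, where 0 ^ ε = 0.
infix 4 _·_^_≤_

_·_^_≤_ : ℝ → ℕ → ℝ → ℕ → Set
c · n ^ ε ≤ m =
  ∀ a b p q .{{_ : ℕ.NonZero b}} .{{_ : ℕ.NonZero p}} .{{_ : ℕ.NonZero q}} →
  fromℚ (+ a ℚ./ b) <ᴿ c → fromℚ (+ p ℚ./ q) <ᴿ ε →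
  a ℕ.^ q ℕ.* n ℕ.^ p ℕ.≤ (b ℕ.* m) ℕ.^ q

infix 8 ℝ^_

ℝ^_ : ℕ → Set
ℝ^ d = Vector ℝ d

module _ {d : ℕ} where

  infix  4 _≈_
  infixl 6 _+_ _-_

  _≈_ : Rel (ℝ^ d) 0ℓ
  x ≈ y = ∀ i → x i ≈ᴿ y i

  _+_ _-_ : ℝ^ d → ℝ^ d → ℝ^ d
  _+_ = zipWith _+ᴿ_
  _-_ = zipWith _-ᴿ_

-- A subset of ℝ^d is a predicate invariant under _≈_. The empty set is allowed.
record IsSemigroup {d : ℕ} (S : Pred (ℝ^ d) 0ℓ) : Set where
  field
    respects : S Respects _≈_
    closed   : ∀ {x y} → S x → S y → S (x + y)

-- The constructor `ext` makes the family one of subsets rather than of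
-- predicates. Every member is invariant under _≈_ because the generators are.
data 𝔄 (d : ℕ) : Pred (Pred (ℝ^ d) 0ℓ) (Level.suc 0ℓ) where
  semigroup    : ∀ {S} → IsSemigroup S → 𝔄 d S
  complement   : ∀ {S} → 𝔄 d S → 𝔄 d (∁ S)
  union        : ∀ {S T} → 𝔄 d S → 𝔄 d T → 𝔄 d (S ∪ T)
  intersection : ∀ {S T} → 𝔄 d S → 𝔄 d T → 𝔄 d (S ∩ T)
  ext          : ∀ {S T} → S ≐ T → 𝔄 d S → 𝔄 d T

-- An n-element subset of ℝ^d is given by an enumeration V without repetitions,
-- and its vertices are referred to by their indices.
Γ : ∀ {d n} → Pred (ℝ^ d) 0ℓ → (Fin n → ℝ^ d) → Rel (Fin n) 0ℓ
Γ S V x y = x ≢ y × S (V y - V x)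

module _ {n : ℕ} (E : Rel (Fin n) 0ℓ) (W : Subset n) where

  IsComplete : Set
  IsComplete = ∀ u v → u ∈ W → v ∈ W → u ≢ v → E u v

  IsIndependent : Set
  IsIndependent = ∀ u v → u ∈ W → v ∈ W → u ≢ v → ¬ E u v

  IsTransitiveTournament : Set
  IsTransitiveTournament =
    ∃[ k ] Σ[ w ∈ (Fin k → Fin n) ]
      Injective _≡_ _≡_ w
      × (∀ v → v ∈ W ⇔ (∃[ i ] w i ≡ v))
      × (∀ i j → E (w i) (w j) ⇔ i Fin.< j)

ErdősHajnal : ∀ {d} → Pred (ℝ^ d) 0ℓ → Set
ErdősHajnal {d} S =
  ∃[ ε ] ∃[ c ] 0ᴿ <ᴿ ε × 0ᴿ <ᴿ c ×
  (∀ n (V : Fin n → ℝ^ d) → Injective _≡_ _≈_ V →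
    ∃[ W ] (c · n ^ ε ≤ ∣ W ∣)
      × (IsComplete (Γ S V) W
         ⊎ IsIndependent (Γ S V) W
         ⊎ IsTransitiveTournament (Γ S V) W))

{-# OPTIONS --safe #-}
-- For a semigroup S the relation y − x ∈ S is transitive by telescoping,
-- (z − y) + (y − x) = z − x. In a sequence of at least a · b points, a transitive
-- relation admits a subsequence of a points that is related along increasing
-- indices, or one of b points that is nowhere so related: if the points with no
-- later successor are fewer than b, recurse on the others and prolong the chain
-- found there by a successor of its last point. Passing to subsequences decides
-- in this way all generators of a Boolean combination, in both directions, at
-- the cost of a fixed power of the length. What remains is complete, independent,
-- or a transitive tournament in the order of the sequence or its reverse.
module Submission where

open import Defs
open import Axiom.ExcludedMiddle using (ExcludedMiddle)
open import Data.Nat.Base using (ℕ; _≤_)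
open import Level using (0ℓ)
open import Relation.Unary using (Pred)

open import Data.Fin.Base as Fin using (Fin; zero; suc)
import Data.Fin.Properties as Fin
open import Data.Fin.Subset using (Subset; ⁅_⁆; ⋃; ∣_∣) renaming (_∈_ to _∈ˢ_)
import Data.Fin.Subset.Properties as Subset
open import Data.Integer.Base as ℤ using (+_)
import Data.Integer.Properties as ℤ
open import Data.List.Base using (List; []; _∷_; map; length; lookup; reverse; allFin)
import Data.List.Properties as List
open import Data.List.Membership.Propositional using (_∈_; find)
open import Data.List.Membership.Propositional.Properties using (∈-lookup; ∈-AllPairs₂)
open import Data.List.Relation.Binary.Sublist.Propositional
  using (_⊆_; []; _∷_; _∷ʳ_; ⊆-trans; from∈; minimum)
open import Data.List.Relation.Binary.Sublist.Propositional.Properties using (All-resp-⊆)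
open import Data.List.Relation.Unary.All as All using (All; []; _∷_)
open import Data.List.Relation.Unary.AllPairs as AllPairs using (AllPairs; []; _∷_)
import Data.List.Relation.Unary.AllPairs.Properties as AllPairs
open import Data.List.Relation.Unary.Any as Any using (Any; here; there)
import Data.List.Relation.Unary.Any.Properties as Any
open import Data.List.Relation.Unary.Linked using (Linked; []; [-]; _∷_)
open import Data.List.Relation.Unary.Linked.Properties using (AllPairs⇒Linked; Linked⇒AllPairs)
open import Data.List.Relation.Unary.Unique.Propositional using (Unique)
import Data.List.Relation.Unary.Unique.Propositional.Properties as Unique
open import Data.Nat.Base as ℕ using (zero; suc; z≤n; s≤s; _^_; _*_; _<_)
import Data.Nat.Properties as ℕ
open import Data.Product.Base using (∃-syntax; ∃₂; _×_; _,_)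
open import Data.Rational.Base as ℚ using (0ℚ; ½)
import Data.Rational.Properties as ℚ
open import Data.Rational.Solver using (module +-*-Solver)
open import Data.Rational.Unnormalised.Base using (mkℚᵘ)
import Data.Rational.Unnormalised.Properties as ℚᵘ
open import Data.Sum.Base as Sum using (_⊎_; inj₁; inj₂; [_,_]′; swap)
open import Function.Base using (_∘_; flip; id)
open import Function.Bundles using (_⇔_; mk⇔)
open import Function.Definitions using (Injective)
open import Relation.Binary.Core using (Rel)
open import Relation.Binary.Definitions using (Transitive; tri<; tri≈; tri>)
open import Relation.Binary.PropositionalEquality
  using (_≡_; _≢_; refl; sym; trans; cong; subst; subst₂; ≢-sym)
open import Relation.Nullary.Decidable.Core using (yes; no)
open import Relation.Nullary.Negation.Core using (¬_; contradiction)

private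
  variable
    A : Set
    R T : Rel A 0ℓ
    xs ys ts us : List A

-- Homogeneous sublists

AllPairs-resp-⊆ : xs ⊆ ys → AllPairs R ys → AllPairs R xs
AllPairs-resp-⊆ []         _          = []
AllPairs-resp-⊆ (_ ∷ʳ p)   (_ ∷ rs)   = AllPairs-resp-⊆ p rs
AllPairs-resp-⊆ (refl ∷ p) (r ∷ rs)   = All-resp-⊆ p r ∷ AllPairs-resp-⊆ p rs

AllPairs-reverse⁺ : AllPairs R xs → AllPairs (flip R) (reverse xs)
AllPairs-reverse⁺ []                         = []
AllPairs-reverse⁺ {xs = x ∷ xs} (r ∷ rs)
  rewrite List.unfold-reverse x xs =
  AllPairs.++⁺ (AllPairs-reverse⁺ rs) ([] ∷ [])
    (All.tabulate λ y∈ → All.lookup r (Any.reverse⁻ y∈) ∷ [])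

AllPairs-lookup : AllPairs R xs → ∀ i j → i Fin.< j → R (lookup xs i) (lookup xs j)
AllPairs-lookup {xs = _ ∷ xs} (r ∷ _)  zero    (suc j) _         = All.lookup r (∈-lookup {xs = xs} j)
AllPairs-lookup               (_ ∷ rs) (suc i) (suc j) (s≤s i<j) = AllPairs-lookup rs i j i<j

-- Only pairs in list order are constrained; the opposite direction is the same notion for `flip R`.
-- Unlike the trichotomy of the theorem, this dichotomy is stable under Boolean combinations:
-- tournaments in two different orders need not combine to anything homogeneous.
Uniform : Rel A 0ℓ → List A → Set
Uniform R xs = AllPairs R xs ⊎ AllPairs (λ x y → ¬ R x y) xs

Uniform-resp-⊆ : xs ⊆ ys → Uniform R ys → Uniform R xs
Uniform-resp-⊆ p = Sum.map (AllPairs-resp-⊆ p) (AllPairs-resp-⊆ p)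

Uniform-¬ : Uniform R xs → Uniform (λ x y → ¬ R x y) xs
Uniform-¬ = swap ∘ Sum.map₁ (AllPairs.map λ r ¬r → ¬r r)

Uniform-⊎ : Uniform R xs → Uniform T xs → Uniform (λ x y → R x y ⊎ T x y) xs
Uniform-⊎ (inj₁ r)  _         = inj₁ (AllPairs.map inj₁ r)
Uniform-⊎ (inj₂ _)  (inj₁ t)  = inj₁ (AllPairs.map inj₂ t)
Uniform-⊎ (inj₂ ¬r) (inj₂ ¬t) =
  inj₂ (AllPairs.zipWith (λ (¬r , ¬t) → [ ¬r , ¬t ]′) (¬r , ¬t))

Uniform-× : Uniform R xs → Uniform T xs → Uniform (λ x y → R x y × T x y) xs
Uniform-× (inj₂ ¬r) _         = inj₂ (AllPairs.map (λ ¬r (r , _) → ¬r r) ¬r)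
Uniform-× (inj₁ _)  (inj₂ ¬t) = inj₂ (AllPairs.map (λ ¬t (_ , t) → ¬t t) ¬t)
Uniform-× (inj₁ r)  (inj₁ t)  = inj₁ (AllPairs.zip (r , t))

Uniform-⇔ : (∀ {x y} → R x y → T x y) → (∀ {x y} → T x y → R x y) →
            Uniform R xs → Uniform T xs
Uniform-⇔ to from = Sum.map (AllPairs.map to) (AllPairs.map (_∘ from))

-- Chains and antichains of a transitive relation

module _ (R : Rel A 0ℓ) where

  -- The successor of a nonterminal entry is sought in the whole tail `xs`, since it may itself be
  -- terminal.
  data TerminalSplit : List A → List A → List A → Set where
    []          : TerminalSplit [] [] []
    terminal    : ∀ {x xs ts us} → ¬ Any (R x) xs →
                  TerminalSplit xs ts us → TerminalSplit (x ∷ xs) (x ∷ ts) us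
    nonterminal : ∀ {x xs ts us} → Any (R x) xs →
                  TerminalSplit xs ts us → TerminalSplit (x ∷ xs) ts (x ∷ us)

module _ {R : Rel A 0ℓ} where

  terminalSplit : ExcludedMiddle 0ℓ → ∀ xs → ∃₂ (TerminalSplit R xs)
  terminalSplit em []       = [] , [] , []
  terminalSplit em (x ∷ xs) with terminalSplit em xs | em {Any (R x) xs}
  ... | ts , us , s | yes p = ts , x ∷ us , nonterminal p s
  ... | ts , us , s | no ¬p = x ∷ ts , us , terminal ¬p s

  terminals-⊆ : TerminalSplit R xs ts us → ts ⊆ xs
  terminals-⊆ []                = []
  terminals-⊆ (terminal _ s)    = refl ∷ terminals-⊆ s
  terminals-⊆ (nonterminal _ s) = _ ∷ʳ terminals-⊆ s

  nonterminals-⊆ : TerminalSplit R xs ts us → us ⊆ xs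
  nonterminals-⊆ []                = []
  nonterminals-⊆ (terminal _ s)    = _ ∷ʳ nonterminals-⊆ s
  nonterminals-⊆ (nonterminal _ s) = refl ∷ nonterminals-⊆ s

  terminals-unrelated : TerminalSplit R xs ts us → AllPairs (λ x y → ¬ R x y) ts
  terminals-unrelated []                = []
  terminals-unrelated (nonterminal _ s) = terminals-unrelated s
  terminals-unrelated (terminal ¬p s)   =
    All-resp-⊆ (terminals-⊆ s) (All.tabulate λ y∈ r → ¬p (Any.map (λ { refl → r }) y∈))
    ∷ terminals-unrelated s

  split-length : TerminalSplit R xs ts us → length xs ≡ length ts ℕ.+ length us
  split-length []                = refl
  split-length (terminal _ s)    = cong suc (split-length s)
  split-length (nonterminal _ s) = trans (cong suc (split-length s)) (sym (ℕ.+-suc _ _))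

  -- The last entry of a chain of nonterminal points has a successor further on in `xs`, which is
  -- appended. `Linked` asks for this one new link only, and keeping the head `y` fixed lets the
  -- recursion retain the link leading into it.
  prolong-∷ : ∀ {y} → TerminalSplit R xs ts us → y ∷ ys ⊆ us → Linked R (y ∷ ys) →
              ∃[ zs ] y ∷ zs ⊆ xs × length zs ≡ suc (length ys) × Linked R (y ∷ zs)
  prolong-∷ (terminal _ s) p rs with prolong-∷ s p rs
  ... | zs , q , eq , rs′ = zs , _ ∷ʳ q , eq , rs′
  prolong-∷ (nonterminal _ s) (_ ∷ʳ p) rs with prolong-∷ s p rs
  ... | zs , q , eq , rs′ = zs , _ ∷ʳ q , eq , rs′
  prolong-∷ (nonterminal r s) (refl ∷ p) [-] with find r
  ... | z , z∈ , Ryz = z ∷ [] , refl ∷ from∈ z∈ , refl , Ryz ∷ [-]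
  prolong-∷ (nonterminal _ s) (refl ∷ p) (Ryz ∷ rs) with prolong-∷ s p rs
  ... | zs , q , eq , rs′ = _ , refl ∷ q , cong suc eq , Ryz ∷ rs′

  -- An empty chain has no last entry to start from; the head of `xs` then serves, whence the
  -- nonemptiness hypothesis.
  prolong : 0 < length xs → TerminalSplit R xs ts us → ys ⊆ us → Linked R ys →
            ∃[ zs ] zs ⊆ xs × length zs ≡ suc (length ys) × Linked R zs
  prolong {xs = x ∷ xs} {ys = []} _ _ _ _ = x ∷ [] , refl ∷ minimum xs , refl , [-]
  prolong {ys = y ∷ ys} _ s p rs with prolong-∷ s p rs
  ... | zs , q , eq , rs′ = y ∷ zs , q , cong suc eq , rs′

  chain-or-antichain : ExcludedMiddle 0ℓ → Transitive R → ∀ a b xs → a * b ≤ length xs →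
    (∃[ ys ] ys ⊆ xs × a ≤ length ys × AllPairs R ys) ⊎
    (∃[ ys ] ys ⊆ xs × b ≤ length ys × AllPairs (λ x y → ¬ R x y) ys)
  chain-or-antichain em tr zero b xs _ = inj₁ ([] , minimum xs , z≤n , [])
  chain-or-antichain em tr (suc a) b xs h with terminalSplit em xs
  ... | ts , us , s with b ℕ.≤? length ts
  ...   | yes b≤ = inj₂ (ts , terminals-⊆ s , b≤ , terminals-unrelated s)
  ...   | no  b≰ = [ inj₁ ∘ extend , inj₂ ∘ weaken ]′ (chain-or-antichain em tr a b us a*b≤us)
    where
    ts<b : length ts < b
    ts<b = ℕ.≰⇒> b≰

    a*b≤us : a * b ≤ length us
    a*b≤us = ℕ.+-cancelˡ-≤ b _ _ (begin
      b ℕ.+ a * b               ≤⟨ h ⟩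
      length xs                 ≡⟨ split-length s ⟩
      length ts ℕ.+ length us   ≤⟨ ℕ.+-monoˡ-≤ (length us) (ℕ.<⇒≤ ts<b) ⟩
      b ℕ.+ length us           ∎)
      where open ℕ.≤-Reasoning

    -- `length ts < b` forces `b` to be positive, and `b` is a summand of the lower bound `h`.
    0<xs : 0 < length xs
    0<xs = ℕ.≤-trans (s≤s z≤n) (ℕ.≤-trans ts<b (ℕ.≤-trans (ℕ.m≤m+n b (a * b)) h))

    extend : (∃[ ys ] ys ⊆ us × a ≤ length ys × AllPairs R ys) →
             ∃[ zs ] zs ⊆ xs × suc a ≤ length zs × AllPairs R zs
    -- Transitivity turns the consecutive links of the prolonged chain back into relations between
    -- all pairs.
    extend (ys , p , a≤ , rs) with prolong 0<xs s p (AllPairs⇒Linked rs)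
    ... | zs , q , eq , rs′ =
      zs , q , subst (suc a ≤_) (sym eq) (s≤s a≤) , Linked⇒AllPairs tr rs′

    weaken : ∀ {P : List A → Set} → ∃[ ys ] ys ⊆ us × P ys → ∃[ ys ] ys ⊆ xs × P ys
    weaken (ys , p , P) = ys , ⊆-trans p (nonterminals-⊆ s) , P

-- Uniform sublists for Boolean combinations of semigroups

HasUniformSublists : ℕ → (List A → Set) → Set
HasUniformSublists {A} k P =
  ∀ m (xs : List A) → m ^ k ≤ length xs → ∃[ ys ] ys ⊆ xs × m ≤ length ys × P ys

-- Two extractions in succession: from `(m ^ l) ^ k` entries to `m ^ l`, then to `m`, so the
-- exponents multiply. The property gained first survives the second extraction because it passes to
-- sublists.
combine : ∀ {k l} {P Q U : List A → Set} →
          (∀ {xs ys} → xs ⊆ ys → P ys → P xs) → (∀ {xs} → P xs → Q xs → U xs) →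
          HasUniformSublists k P → HasUniformSublists l Q → HasUniformSublists (l * k) U
combine {k = k} {l} resp f hP hQ m xs h
  with hP (m ^ l) xs (subst (_≤ length xs) (sym (ℕ.^-*-assoc m l k)) h)
... | ys , p , m^l≤ , Pys with hQ m ys m^l≤
...   | zs , q , m≤ , Qzs = zs , ⊆-trans q p , m≤ , f (resp q Pys) Qzs

map-uniform : ∀ {k} {P Q : List A → Set} → (∀ {xs} → P xs → Q xs) →
                 HasUniformSublists k P → HasUniformSublists k Q
map-uniform f h m xs m≤ with h m xs m≤
... | ys , p , m≤′ , Pys = ys , p , m≤′ , f Pys

transitive⇒uniform : ExcludedMiddle 0ℓ → Transitive R → HasUniformSublists 2 (Uniform R)
transitive⇒uniform em tr m xs h
  with chain-or-antichain em tr m m xs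
         (subst (_≤ length xs) (cong (m *_) (ℕ.*-identityʳ m)) h)
... | inj₁ (ys , p , m≤ , rs) = ys , p , m≤ , inj₁ rs
... | inj₂ (ys , p , m≤ , rs) = ys , p , m≤ , inj₂ rs

-- The exponent is fixed before `A` and `δ`: it must serve all point configurations, and both
-- differences and reversed differences. Writing it as `suc k` keeps it positive, so that its
-- reciprocal exists.
𝔄⇒uniform : ExcludedMiddle 0ℓ → ∀ {d} {S : Pred (ℝ^ d) 0ℓ} → 𝔄 d S →
  ∃[ k ] (∀ {A : Set} (δ : A → A → ℝ^ d) →
    (∀ {T} → IsSemigroup T → Transitive (λ x y → T (δ x y))) →
    HasUniformSublists (suc k) (Uniform (λ x y → S (δ x y))))
𝔄⇒uniform em (semigroup sg) = 1 , λ δ tr → transitive⇒uniform em (tr sg)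
𝔄⇒uniform em (complement s) with 𝔄⇒uniform em s
... | k , h = k , λ δ tr → map-uniform {k = suc k} Uniform-¬ (h δ tr)
𝔄⇒uniform em (union s t) with 𝔄⇒uniform em s | 𝔄⇒uniform em t
-- The product `suc l * suc k` unfolds to the successor of this number.
... | k , h | l , h′ = k ℕ.+ l * suc k , λ δ tr →
  combine {k = suc k} {suc l} Uniform-resp-⊆ Uniform-⊎ (h δ tr) (h′ δ tr)
𝔄⇒uniform em (intersection s t) with 𝔄⇒uniform em s | 𝔄⇒uniform em t
... | k , h | l , h′ = k ℕ.+ l * suc k , λ δ tr →
  combine {k = suc k} {suc l} Uniform-resp-⊆ Uniform-× (h δ tr) (h′ δ tr)
𝔄⇒uniform em (ext (to , from) s) with 𝔄⇒uniform em s
... | k , h = k , λ δ tr → map-uniform {k = suc k} (Uniform-⇔ to from) (h δ tr)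

difference-transitive : ∀ {d} {T : Pred (ℝ^ d) 0ℓ} → IsSemigroup T →
  ∀ {x y z} → T (y - x) → T (z - y) → T (z - x)
difference-transitive sg {x} {y} {z} y-x z-y =
  IsSemigroup.respects sg telescope (IsSemigroup.closed sg z-y y-x)
  where
  telescope : ((z - y) + (y - x)) ≈ (z - x)
  -- The approximating sequences agree term by term, so index 0 works for every `ε`.
  telescope i ε 0<ε = 0 , λ n _ →
    subst (ℚ._< ε)
      (sym (cong ℚ.∣_∣ (cancel (approx (z i) n) (approx (y i) n) (approx (x i) n)))) 0<ε
    where
    open +-*-Solver
    cancel : ∀ c b a → ((c ℚ.- b) ℚ.+ (b ℚ.- a)) ℚ.- (c ℚ.- a) ≡ 0ℚ
    cancel = solve 3 (λ c b a → ((c :- b) :+ (b :- a)) :- (c :- a) := con 0ℚ) refl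

-- Vertex sets given by lists

module _ {n : ℕ} where

  fromList : List (Fin n) → Subset n
  fromList xs = ⋃ (map ⁅_⁆ xs)

  ∈-fromList⁺ : ∀ {v xs} → v ∈ xs → v ∈ˢ fromList xs
  ∈-fromList⁺ (here refl) = Subset.x∈p∪q⁺ (inj₁ (Subset.x∈⁅x⁆ _))
  ∈-fromList⁺ (there v∈)  = Subset.x∈p∪q⁺ (inj₂ (∈-fromList⁺ v∈))

  ∈-fromList⁻ : ∀ {v} xs → v ∈ˢ fromList xs → v ∈ xs
  ∈-fromList⁻ []       v∈ = contradiction v∈ Subset.∉⊥
  ∈-fromList⁻ (x ∷ xs) v∈ with Subset.x∈p∪q⁻ ⁅ x ⁆ (fromList xs) v∈
  ... | inj₁ v∈x  = here (Subset.x∈⁅y⁆⇒x≡y x v∈x)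
  ... | inj₂ v∈xs = there (∈-fromList⁻ xs v∈xs)

  -- By uniqueness, each entry strictly enlarges the set formed by the entries after it.
  length≤∣fromList∣ : ∀ {xs} → Unique xs → length xs ≤ ∣ fromList xs ∣
  length≤∣fromList∣ []                         = z≤n
  length≤∣fromList∣ {x ∷ xs} (x∉ ∷ u) = ℕ.≤-<-trans (length≤∣fromList∣ u)
    (Subset.p⊂q⇒∣p∣<∣q∣
      ( Subset.q⊆p∪q ⁅ x ⁆ (fromList xs)
      , x , ∈-fromList⁺ {xs = x ∷ xs} (here refl)
      , λ x∈ → All.lookup x∉ (∈-fromList⁻ xs x∈) refl))

  allPairs-∈ : {R : Rel (Fin n) 0ℓ} → ∀ {xs} → AllPairs R xs → AllPairs (flip R) xs →
    ∀ {u v} → u ∈ xs → v ∈ xs → u ≢ v → R u v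
  allPairs-∈ rs rs′ u∈ v∈ u≢v with ∈-AllPairs₂ (AllPairs.zip (rs , rs′)) u∈ v∈
  ... | inj₁ u≡v              = contradiction u≡v u≢v
  ... | inj₂ (inj₁ (r , _)) = r
  ... | inj₂ (inj₂ (_ , r)) = r

  isTransitiveTournament : ∀ {R : Rel (Fin n) 0ℓ} {xs} → Unique xs →
    AllPairs R xs → AllPairs (λ x y → ¬ R y x) xs →
    IsTransitiveTournament (λ x y → x ≢ y × R x y) (fromList xs)
  isTransitiveTournament {R} {xs} uniq rs ¬rs =
    length xs , w , injective , member , λ i j → mk⇔ (edge⇒< i j) (<⇒edge i j)
    where
    w = lookup xs

    distinct : ∀ {i j} → i Fin.< j → w i ≢ w j
    distinct = AllPairs-lookup uniq _ _

    injective : Injective _≡_ _≡_ w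
    injective {i} {j} eq with Fin.<-cmp i j
    ... | tri< i<j _ _ = contradiction eq (distinct i<j)
    ... | tri≈ _ i≡j _ = i≡j
    ... | tri> _ _ j<i = contradiction (sym eq) (distinct j<i)

    member : ∀ v → v ∈ˢ fromList xs ⇔ (∃[ i ] w i ≡ v)
    member v = mk⇔
      (λ v∈ → let v∈xs = ∈-fromList⁻ xs v∈ in Any.index v∈xs , sym (Any.lookup-index v∈xs))
      (λ { (i , refl) → ∈-fromList⁺ (∈-lookup {xs = xs} i) })

    edge⇒< : ∀ i j → w i ≢ w j × R (w i) (w j) → i Fin.< j
    edge⇒< i j (wi≢wj , r) with Fin.<-cmp i j
    ... | tri< i<j _ _  = i<j
    ... | tri≈ _ refl _ = contradiction refl wi≢wj
    ... | tri> _ _ j<i  = contradiction r (AllPairs-lookup ¬rs j i j<i)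

    <⇒edge : ∀ i j → i Fin.< j → w i ≢ w j × R (w i) (w j)
    <⇒edge i j i<j = distinct i<j , AllPairs-lookup rs i j i<j

  homogeneous : ∀ {R : Rel (Fin n) 0ℓ} {xs} → Unique xs → Uniform R xs → Uniform (flip R) xs →
    let E = λ x y → x ≢ y × R x y in
    ∃[ W ] length xs ≤ ∣ W ∣ × (IsComplete E W ⊎ IsIndependent E W ⊎ IsTransitiveTournament E W)
  homogeneous {xs = xs} uniq (inj₁ rs) (inj₁ rs′) =
    fromList xs , length≤∣fromList∣ uniq , inj₁ λ u v u∈ v∈ u≢v →
      u≢v , allPairs-∈ rs rs′ (∈-fromList⁻ xs u∈) (∈-fromList⁻ xs v∈) u≢v
  homogeneous {xs = xs} uniq (inj₂ ¬rs) (inj₂ ¬rs′) =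
    fromList xs , length≤∣fromList∣ uniq , inj₂ (inj₁ λ u v u∈ v∈ u≢v (_ , r) →
      allPairs-∈ ¬rs ¬rs′ (∈-fromList⁻ xs u∈) (∈-fromList⁻ xs v∈) u≢v r)
  homogeneous {xs = xs} uniq (inj₁ rs) (inj₂ ¬rs′) =
    fromList xs , length≤∣fromList∣ uniq , inj₂ (inj₂ (isTransitiveTournament uniq rs ¬rs′))
  -- All edges run from later to earlier entries, so the reversed list enumerates the tournament.
  homogeneous {xs = xs} uniq (inj₂ ¬rs) (inj₁ rs′) =
    fromList (reverse xs) ,
    subst (_≤ ∣ fromList (reverse xs) ∣) (List.length-reverse xs) (length≤∣fromList∣ uniq′) ,
    inj₂ (inj₂ (isTransitiveTournament uniq′ (AllPairs-reverse⁺ rs′) (AllPairs-reverse⁺ ¬rs)))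
    where
    uniq′ : Unique (reverse xs)
    uniq′ = AllPairs.map ≢-sym (AllPairs-reverse⁺ uniq)

-- The exponent

integerRoot : ∀ k n → ∃[ m ] m ^ suc k ≤ n × n < suc m ^ suc k
integerRoot k zero    = 0 , z≤n , ℕ.m^n>0 1 (suc k)
integerRoot k (suc n) with integerRoot k n
... | m , m^k≤n , n< with suc m ^ suc k ℕ.≤? suc n
...   | no  ≰ = m , ℕ.m≤n⇒m≤1+n m^k≤n , ℕ.≰⇒> ≰
-- The root grows by at most one: `suc n` is at most `suc m ^ suc k`, hence below the next power.
...   | yes ≤ = suc m , ≤ , ℕ.≤-<-trans n< (ℕ.^-monoˡ-< (suc k) (ℕ.n<1+n (suc m)))

*-^-distrib : ∀ a b q → (a * b) ^ q ≡ a ^ q * b ^ q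
*-^-distrib a b zero    = refl
*-^-distrib a b (suc q) =
  trans (cong (a * b *_) (*-^-distrib a b q)) (ℕ.[m*n]*[o*p]≡[m*o]*[n*p] a b (a ^ q) (b ^ q))

fromℚ-<-cross : ∀ a b c d .{{_ : ℕ.NonZero b}} .{{_ : ℕ.NonZero d}} →
  fromℚ (+ a ℚ./ b) <ᴿ fromℚ (+ c ℚ./ d) → a * d ≤ c * b
fromℚ-<-cross a b@(suc b-1) c d@(suc d-1) (δ , 0<δ , N , h) =
  ℤ.drop‿+≤+
    (subst₂ ℤ._≤_ (sym (ℤ.pos-* a d)) (sym (ℤ.pos-* c b)) (ℚᵘ.drop-*≤* a/b≤c/d))
  where
  a/b≤c/d =
    ℚᵘ.≤-respˡ-≃ (ℚ.toℚᵘ-fromℚᵘ (mkℚᵘ (+ a) b-1))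
      (ℚᵘ.≤-respʳ-≃ (ℚ.toℚᵘ-fromℚᵘ (mkℚᵘ (+ c) d-1))
        (ℚ.toℚᵘ-mono-≤ (begin
          + a ℚ./ b           ≡⟨ ℚ.+-identityʳ _ ⟨
          + a ℚ./ b ℚ.+ 0ℚ    ≤⟨ ℚ.+-monoʳ-≤ (+ a ℚ./ b) (ℚ.<⇒≤ 0<δ) ⟩
          + a ℚ./ b ℚ.+ δ     ≤⟨ h N ℕ.≤-refl ⟩
          + c ℚ./ d           ∎)))
    where open ℚ.≤-Reasoning

0<fromℚ : ∀ q → 0ℚ ℚ.< q → 0ᴿ <ᴿ fromℚ q
0<fromℚ q 0<q = q , 0<q , 0 , λ _ _ → ℚ.≤-reflexive (ℚ.+-identityˡ q)

-- For positive `m`, the root of `n` is below `suc m`, which is at most `2 * m`; this is where the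
-- constant ½ comes from.
integerRoot-bound : ∀ k {m n w} → n < suc m ^ suc k → m ≤ w →
  fromℚ ½ · n ^ fromℚ (+ 1 ℚ./ suc k) ≤ w
-- Here `n` is 0, and the positive exponent `suc p` makes its power vanish.
integerRoot-bound k {zero} {n} n<1 _ a b (suc p) q _ _
  rewrite ℕ.n<1⇒n≡0 (subst (n <_) (ℕ.^-zeroˡ (suc k)) n<1)
        | ℕ.*-zeroʳ (a ^ q) = z≤n
integerRoot-bound k {m@(suc m-1)} {n} {w} n< m≤w a b p q a/b<½ p/q<ε = begin
  a ^ q * n ^ p                     ≤⟨ ℕ.*-monoʳ-≤ (a ^ q) (ℕ.^-monoˡ-≤ p (ℕ.<⇒≤ n<)) ⟩
  a ^ q * (suc m ^ suc k) ^ p       ≡⟨ cong (a ^ q *_) (ℕ.^-*-assoc (suc m) (suc k) p) ⟩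
  a ^ q * suc m ^ (suc k * p)       ≤⟨ ℕ.*-monoʳ-≤ (a ^ q) (ℕ.^-monoʳ-≤ (suc m) kp≤q) ⟩
  a ^ q * suc m ^ q                 ≡⟨ *-^-distrib a (suc m) q ⟨
  (a * suc m) ^ q                   ≤⟨ ℕ.^-monoˡ-≤ q am≤bw ⟩
  (b * w) ^ q                       ∎
  where
  open ℕ.≤-Reasoning

  kp≤q : suc k * p ≤ q
  kp≤q = begin
    suc k * p  ≡⟨ ℕ.*-comm (suc k) p ⟩
    p * suc k  ≤⟨ fromℚ-<-cross p q 1 (suc k) p/q<ε ⟩
    1 * q      ≡⟨ ℕ.*-identityˡ q ⟩
    q          ∎

  am≤bw : a * suc m ≤ b * w
  am≤bw = begin
    a * suc m      ≤⟨ ℕ.*-monoʳ-≤ a (ℕ.+-monoˡ-≤ m {1} {m} (s≤s z≤n)) ⟩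
    a * (m ℕ.+ m)  ≡⟨ cong (λ z → a * (m ℕ.+ z)) (ℕ.+-identityʳ m) ⟨
    a * (2 * m)    ≡⟨ ℕ.*-assoc a 2 m ⟨
    a * 2 * m      ≤⟨ ℕ.*-mono-≤ (fromℚ-<-cross a b 1 2 a/b<½) m≤w ⟩
    1 * b * w      ≡⟨ cong (_* w) (ℕ.*-identityˡ b) ⟩
    b * w          ∎

-- Homogeneous vertex sets of power size

uniform⇒homogeneous : ∀ k {n} {R : Rel (Fin n) 0ℓ} →
  HasUniformSublists (suc k) (λ xs → Uniform R xs × Uniform (flip R) xs) →
  let E = λ x y → x ≢ y × R x y in
  ∃[ W ] (fromℚ ½ · n ^ fromℚ (+ 1 ℚ./ suc k) ≤ ∣ W ∣)
    × (IsComplete E W ⊎ IsIndependent E W ⊎ IsTransitiveTournament E W)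
uniform⇒homogeneous k {n} h =
  let m , m^k≤n , n<         = integerRoot k n
      ys , p , m≤ , fwd , bwd = h m (allFin n)
        (subst (m ^ suc k ≤_) (sym (List.length-tabulate id)) m^k≤n)
      W , ys≤W , hom         = homogeneous (AllPairs-resp-⊆ p (Unique.allFin⁺ n)) fwd bwd
  in W , integerRoot-bound k n< (ℕ.≤-trans m≤ ys≤W) , hom

mainTheorem3 : ExcludedMiddle 0ℓ →
    ∀ (d : ℕ) → 1 ≤ d →
    ∀ (S : Pred (ℝ^ d) 0ℓ) → 𝔄 d S → ErdősHajnal S
mainTheorem3 em d _ S S∈𝔄 =
  let k , uniform = 𝔄⇒uniform em S∈𝔄
      -- `suc l` is `suc k * suc k`: the extraction is carried out once for each direction.
      l = k ℕ.+ k * suc k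
  in
  fromℚ (+ 1 ℚ./ suc l) , fromℚ ½ ,
  0<fromℚ _ (ℚ.positive⁻¹ _ {{ℚ.normalize-pos 1 (suc l)}}) , 0<fromℚ _ (ℚ.positive⁻¹ ½) ,
  λ n V _ → uniform⇒homogeneous l
    (combine {k = suc k} {suc k} Uniform-resp-⊆ _,_
      (uniform (λ x y → V y - V x) λ sg {x} {y} {z} →
        difference-transitive sg {V x} {V y} {V z})
      -- Reversed differences give uniformity of the flipped relation; they compose in the opposite
      -- order.
      (uniform (λ x y → V x - V y) λ sg {x} {y} {z} →
        flip (difference-transitive sg {V z} {V y} {V x})))
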